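{- For all positive integers $n$, $B_{n,1}(1!u_1,2!u_2,\ldots,n!u_n)=n!u_n$ and $B_{n,n}(u_1)=u_1^n$. When $n\ge 2$ and $[n/2]<k\le n$, $$B_{n,k}(1!u_1,2!u_2,\ldots,(n-k+1)!u_{n-k+1})=n\,B_{n-1,k-1}(1!u_1,2!u_2,\ldots,(n-k+1)!u_{n-k+1})\big|_{k_1\to k_1+1}.$$ When $n\ge 4$ and $2\le k\le [n/2]$, $$B_{n,k}(1!u_1,2!u_2,\ldots,(n-k+1)!u_{n-k+1})=n\,B_{n-1,k-1}(1!u_1,2!u_2,\ldots,(n-k+1)!u_{n-k+1})\big|_{k_1\to k_1+1}+(n)_k\,B_{n-k,k}(1!u_2,2!u_3,\ldots,(n-2k+1)!u_{n-2k+2}).$$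
   Context: $[x]$ denotes the integer part of $x$ and $(n)_k=n(n-1)\cdots(n-k+1)$ the falling factorial. For integers $1\le k\le n$, the partial exponential Bell polynomial is $$B_{n,k}(x_1,\ldots,x_{n-k+1})=n!\sum_{\Lambda^k_n}\prod_{j=1}^{n-k+1}\frac{1}{k_j!}\Big(\frac{x_j}{j!}\Big)^{k_j},$$ where the sum is over $\Lambda^k_n=\{(k_1,\ldots,k_{n-k+1}): \sum_j k_j=k,\ \sum_j jk_j=n,\ k_j\in\mathbb{Z}_{\ge 0}\}$. The notation $|_{k_1\to k_1+1}$ means that in each summand of the defining sum $k_1$ is replaced by $k_1+1$ (the index set being unchanged), i.e. $$B_{n-1,k-1}(1!u_1,\ldots,(n-k+1)!u_{n-k+1})\big|_{k_1\to k_1+1}=(n-1)!\sum_{(k_1,\ldots,k_{n-k+1})\in\Lambda^{k-1}_{n-1}}\frac{u_1^{k_1+1}}{(k_1+1)!}\prod_{j=2}^{n-k+1}\frac{u_j^{k_j}}{k_j!}.$$ -}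

module Defs where

open import Algebra.Bundles using (CommutativeRing; Semiring)
import Algebra.Definitions.RawSemiring as RawSemiringDefs
open import Data.Fin.Base using (Fin; zero; suc; toℕ)
open import Data.Integer.Base using (+_)
open import Data.List.Base as List using (List)
open import Data.List.Membership.Propositional using (_∈_)
open import Data.List.Membership.Propositional.Properties
  using (∈-cartesianProductWith⁺; ∈-filter⁺; ∈-filter⁻; ∈-upTo⁺)
open import Data.List.Relation.Unary.Any using (here)
open import Data.List.Relation.Unary.All using ([])
open import Data.List.Relation.Unary.AllPairs using ([]; _∷_)
open import Data.List.Relation.Unary.Unique.Propositional using (Unique)
import Data.List.Relation.Unary.Unique.Propositional.Properties as Unique
open import Data.Nat.Base as ℕ using (ℕ; zero; suc; _∸_; _!; _≤_; s≤s)
import Data.Nat.Properties as ℕ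
open import Data.Product.Base using (_×_; _,_; proj₁; proj₂)
open import Data.Rational.Base as ℚ using (ℚ)
open import Data.Vec.Base as Vec using (Vec; []; _∷_; lookup; tabulate; updateAt)
open import Data.Vec.Functional using (Vector)
open import Data.Vec.Properties using (∷-injective)
open import Function.Bundles using (_⇔_; mk⇔)
open import Relation.Binary.PropositionalEquality using (_≡_; refl; subst)
open import Relation.Nullary.Decidable using (Dec; _×-dec_)

-- Position i : Fin m of a tuple carries the (1-based) index j = suc (toℕ i);
-- so ⟨ a ⟩ is (a 1 , … , a m), and a 0 is never used.
⟨_⟩ : ∀ {a} {A : Set a} {m} → (ℕ → A) → Vector A m
⟨ a ⟩ i = a (suc (toℕ i))

weight : ∀ {m} → Vec ℕ m → ℕ
weight ks = Vec.sum (tabulate λ i → suc (toℕ i) ℕ.* lookup ks i)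

IsIndex : ∀ (n k : ℕ) {m} → Vec ℕ m → Set
IsIndex n k ks = Vec.sum ks ≡ k × weight ks ≡ n

isIndex? : ∀ n k {m} (ks : Vec ℕ m) → Dec (IsIndex n k ks)
isIndex? n k ks = (Vec.sum ks ℕ.≟ k) ×-dec (weight ks ℕ.≟ n)

box : ∀ (m b : ℕ) → List (Vec ℕ m)
box zero    b = List.[ [] ]
box (suc m) b = List.cartesianProductWith _∷_ (List.upTo (suc b)) (box m b)

-- The condition Σ kⱼ = k bounds every entry by k, so filtering the box loses
-- nothing: see ∈-Λ and Λ-unique.
Λ : ∀ n k → List (Vec ℕ (suc (n ∸ k)))
Λ n k = List.filter (isIndex? n k) (box (suc (n ∸ k)) k)

∈-box : ∀ {m} b (ks : Vec ℕ m) → Vec.sum ks ≤ b → ks ∈ box m b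
∈-box b []       _ = here refl
∈-box b (k ∷ ks) p = ∈-cartesianProductWith⁺ _∷_
  (∈-upTo⁺ (s≤s (ℕ.m+n≤o⇒m≤o k p)))
  (∈-box b ks (ℕ.m+n≤o⇒n≤o k p))

∈-Λ : ∀ n k (ks : Vec ℕ (suc (n ∸ k))) → ks ∈ Λ n k ⇔ IsIndex n k ks
∈-Λ n k ks = mk⇔
  (λ ks∈ → proj₂ (∈-filter⁻ (isIndex? n k) {xs = box (suc (n ∸ k)) k} ks∈))
  (λ ix → ∈-filter⁺ (isIndex? n k) (∈-box k ks (ℕ.≤-reflexive (proj₁ ix))) ix)

box-unique : ∀ m b → Unique (box m b)
box-unique zero    b = [] ∷ []
box-unique (suc m) b = Unique.cartesianProductWith⁺ _∷_ ∷-injective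
  (Unique.upTo⁺ (suc b)) (box-unique m b)

Λ-unique : ∀ n k → Unique (Λ n k)
Λ-unique n k = Unique.filter⁺ (isIndex? n k) (box-unique (suc (n ∸ k)) k)

-- Bell polynomials evaluated in a commutative ℚ-algebra R; the map ι is
-- intended to be a ring homomorphism, and supplies the rational coefficients.
module Bell {c ℓ} (R : CommutativeRing c ℓ)
            (ι : ℚ → CommutativeRing.Carrier R) where

  open CommutativeRing R public using (Carrier; _≈_; _+_; _*_; 0#)
  open RawSemiringDefs (Semiring.rawSemiring (CommutativeRing.semiring R)) public
    using (_^_; product) renaming (_×_ to _·_)

  1/_! : ℕ → Carrier
  1/ n ! = ι (ℚ._/_ (+ 1) (n !) {{n ℕ.!≢0}})

  ∑ : ∀ {a} {A : Set a} → List A → (A → Carrier) → Carrier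
  ∑ xs f = List.foldr _+_ 0# (List.map f xs)

  summand : ∀ {m} → Vector Carrier m → Vec ℕ m → Carrier
  summand x ks = product λ i →
    1/ lookup ks i ! * (x i * 1/ suc (toℕ i) !) ^ lookup ks i

  -- Meaningful for 1 ≤ k ≤ n, where suc (n ∸ k) is n - k + 1.
  B : ∀ n k → Vector Carrier (suc (n ∸ k)) → Carrier
  B n k x = (n !) · ∑ (Λ n k) λ ks → summand x ks

  B[k₁→k₁+1] : ∀ n k → Vector Carrier (suc (n ∸ k)) → Carrier
  B[k₁→k₁+1] n k x = (n !) · ∑ (Λ n k) λ ks → summand x (updateAt ks zero suc)

{-# OPTIONS --safe #-}
module Submission where

-- Split the tuples of Λ n k by whether k₁ vanishes. Those with k₁ > 0 are the
-- tuples of Λ (n - 1) (k - 1) with k₁ increased by one. Those with k₁ = 0 become,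
-- after shifting the indices down by one, the tuples of Λ (n - k) k; there are
-- none when 2k > n, since every tuple has Σ kⱼ ≤ Σ j kⱼ. The factors n! are
-- distributed by n! = n (n - 1)! = (n)ₖ (n - k)!.

open import Defs
open import Algebra.Bundles using (CommutativeRing)
open import Algebra.Morphism.Structures using (IsRingHomomorphism)
import Algebra.Properties.CommutativeMonoid.Mult as CommutativeMonoidMult
import Algebra.Properties.CommutativeSemiring.Exp as CommutativeSemiringExp
import Algebra.Properties.Semiring.Mult as SemiringMult
open import Data.Fin.Base using (zero; suc; toℕ)
open import Data.Integer.Base using (+_)
import Data.Integer.Properties as ℤ
import Data.Integer.Solver as ℤ
open import Data.List.Base as List using (List; []; _∷_; _++_; map)
open import Data.List.Membership.Propositional using (_∈_)
open import Data.List.Membership.Propositional.Properties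
  using (∈-map⁺; ∈-map⁻; ∈-++⁺ˡ; ∈-++⁺ʳ; ∈-++⁻)
open import Data.List.Membership.Propositional.Properties.WithK using (unique∧set⇒bag)
open import Data.List.Properties using (++-identityʳ; map-∘)
open import Data.List.Relation.Binary.BagAndSetEquality using (∼bag⇒↭)
open import Data.List.Relation.Binary.Permutation.Propositional using (_↭_; ↭⇒↭ₛ′)
open import Data.List.Relation.Binary.Permutation.Propositional.Properties using (map⁺)
import Data.List.Relation.Binary.Permutation.Setoid.Properties as Permutation
open import Data.List.Relation.Unary.All using ([])
open import Data.List.Relation.Unary.AllPairs using ([]; _∷_)
open import Data.List.Relation.Unary.Any using (here)
open import Data.List.Relation.Unary.Unique.Propositional using (Unique)
import Data.List.Relation.Unary.Unique.Propositional.Properties as Unique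
open import Data.Nat.Base as ℕ
  using (ℕ; zero; suc; _∸_; _!; _≤_; _<_; z≤n; s≤s; s≤s⁻¹; ⌊_/2⌋; ⌈_/2⌉)
open import Data.Nat.Combinatorics using (_P_; nPk≡n!/[n∸k]!)
open import Data.Nat.Divisibility using (m≤n⇒m!∣n!)
open import Data.Nat.DivMod using (m/n*n≡m)
open import Data.Nat.Properties as ℕ using (_!≢0)
import Data.Nat.Solver as ℕ
open import Data.Product.Base using (_×_; _,_; proj₁; proj₂)
open import Data.Rational.Base as ℚ using (ℚ; +-*-rawRing; _/_; 1ℚ; toℚᵘ; fromℚᵘ)
import Data.Rational.Properties as ℚ
open import Data.Rational.Unnormalised.Base as ℚᵘ using (mkℚᵘ; *≡*)
import Data.Rational.Unnormalised.Properties as ℚᵘ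
open import Data.Sum.Base using (inj₁; inj₂)
open import Data.Vec.Base as Vec using (Vec; []; _∷_; lookup; sum; tabulate; updateAt)
open import Data.Vec.Functional using (Vector)
open import Data.Vec.Properties using (∷-injectiveʳ)
open import Function.Base using (_∘_; _$_)
open import Function.Bundles using (_⇔_; mk⇔; Equivalence)
open import Relation.Binary.PropositionalEquality
  using (_≡_; refl; sym; trans; cong; cong₂; subst; subst₂; module ≡-Reasoning)
import Relation.Binary.Reasoning.Setoid as SetoidReasoning
open import Relation.Nullary.Negation using (contradiction)

open Equivalence using (to; from)

-- Sums and weights of tuples

sum-tabulate-lookup-+ : ∀ {m} (ks : Vec ℕ m) (f : _ → ℕ) →
  sum (tabulate λ i → lookup ks i ℕ.+ f i) ≡ sum ks ℕ.+ sum (tabulate f)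
sum-tabulate-lookup-+ []       f = refl
sum-tabulate-lookup-+ (k ∷ ks) f = begin
  (k ℕ.+ f zero) ℕ.+ sum (tabulate λ i → lookup ks i ℕ.+ f (suc i))
    ≡⟨ cong (k ℕ.+ f zero ℕ.+_) (sum-tabulate-lookup-+ ks (f ∘ suc)) ⟩
  (k ℕ.+ f zero) ℕ.+ (sum ks ℕ.+ sum (tabulate (f ∘ suc)))
    ≡⟨ solve 4 (λ a b c d → (a :+ b) :+ (c :+ d) := (a :+ c) :+ (b :+ d)) refl
         k (f zero) (sum ks) _ ⟩
  (k ℕ.+ sum ks) ℕ.+ (f zero ℕ.+ sum (tabulate (f ∘ suc))) ∎
  where open ≡-Reasoning; open ℕ.+-*-Solver

-- In `k ∷ ks` every entry of the tail stands one position further right, so it counts once more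
-- than in `weight ks`. This makes inductions on tuples possible.
weight-∷ : ∀ {m} k (ks : Vec ℕ m) → weight (k ∷ ks) ≡ k ℕ.+ (sum ks ℕ.+ weight ks)
weight-∷ k ks = cong₂ ℕ._+_ (ℕ.*-identityˡ k)
  (sum-tabulate-lookup-+ ks λ i → suc (toℕ i) ℕ.* lookup ks i)

sum≤weight : ∀ {m} (ks : Vec ℕ m) → sum ks ≤ weight ks
sum≤weight []       = z≤n
sum≤weight (k ∷ ks) = begin
  k ℕ.+ sum ks                  ≤⟨ ℕ.+-monoʳ-≤ k (ℕ.m≤m+n (sum ks) (weight ks)) ⟩
  k ℕ.+ (sum ks ℕ.+ weight ks)  ≡⟨ weight-∷ k ks ⟨
  weight (k ∷ ks)               ∎
  where open ℕ.≤-Reasoning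

sum≡0⇒weight≡0 : ∀ {m} (ks : Vec ℕ m) → sum ks ≡ 0 → weight ks ≡ 0
sum≡0⇒weight≡0 []          _  = refl
sum≡0⇒weight≡0 (zero ∷ ks) eq =
  trans (weight-∷ 0 ks) (cong₂ ℕ._+_ eq (sum≡0⇒weight≡0 ks eq))

-- Λ n k and Λ (n - k) k consist of tuples of different lengths; tuples are
-- compared by padding with zeros or cutting off.
resize : ∀ p {m} → Vec ℕ m → Vec ℕ p
resize zero    ks       = []
resize (suc p) []       = 0 ∷ resize p []
resize (suc p) (k ∷ ks) = k ∷ resize p ks

sum-resize : ∀ {m p} → m ≤ p → (ks : Vec ℕ m) → sum (resize p ks) ≡ sum ks
sum-resize {p = zero}  _         []       = refl
sum-resize {p = suc p} _         []       = sum-resize {p = p} z≤n []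
sum-resize             (s≤s m≤p) (k ∷ ks) = cong (k ℕ.+_) (sum-resize m≤p ks)

weight-resize : ∀ {m p} → m ≤ p → (ks : Vec ℕ m) → weight (resize p ks) ≡ weight ks
weight-resize {p = p}     _         []       =
  sum≡0⇒weight≡0 (resize p []) (sum-resize {p = p} z≤n [])
weight-resize {p = suc p} (s≤s m≤p) (k ∷ ks) = begin
  weight (k ∷ resize p ks)
    ≡⟨ weight-∷ k (resize p ks) ⟩
  k ℕ.+ (sum (resize p ks) ℕ.+ weight (resize p ks))
    ≡⟨ cong (k ℕ.+_) (cong₂ ℕ._+_ (sum-resize m≤p ks) (weight-resize m≤p ks)) ⟩
  k ℕ.+ (sum ks ℕ.+ weight ks)
    ≡⟨ weight-∷ k ks ⟨
  weight (k ∷ ks) ∎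
  where open ≡-Reasoning

resize-injective : ∀ {m p} → m ≤ p → {ks ls : Vec ℕ m} → resize p ks ≡ resize p ls → ks ≡ ls
resize-injective m≤p       {[]}     {[]}     _  = refl
resize-injective (s≤s m≤p) {k ∷ ks} {l ∷ ls} eq =
  cong₂ _∷_ (cong Vec.head eq) (resize-injective m≤p (∷-injectiveʳ eq))

-- A tuple of weight at most m has no nonzero entry beyond position m.
resize-resize : ∀ {p} m (ks : Vec ℕ p) → weight ks ≤ m → resize p (resize m ks) ≡ ks
resize-resize m       []       _    = refl
resize-resize zero    (k ∷ ks) w≤0 =
  cong₂ _∷_ (sym (ℕ.m+n≡0⇒m≡0 k w≡0))
    (resize-resize zero ks (ℕ.≤-reflexive (ℕ.m+n≡0⇒n≡0 (sum ks) (ℕ.m+n≡0⇒n≡0 k w≡0))))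
  where
  w≡0 : k ℕ.+ (sum ks ℕ.+ weight ks) ≡ 0
  w≡0 = trans (sym (weight-∷ k ks)) (ℕ.n≤0⇒n≡0 w≤0)
resize-resize (suc m) (k ∷ ks) w≤1+m = cong (k ∷_) (resize-resize m ks (tail≤m (sum ks) refl))
  where
  tail≤1+m : sum ks ℕ.+ weight ks ≤ suc m
  tail≤1+m = ℕ.m+n≤o⇒n≤o k (subst (_≤ suc m) (weight-∷ k ks) w≤1+m)

  -- Either the tail vanishes and has weight 0, or its sum is at least 1 and takes at least one unit
  -- from the bound `suc m`.
  tail≤m : ∀ s → sum ks ≡ s → weight ks ≤ m
  tail≤m zero    eq = ℕ.≤-trans (ℕ.≤-reflexive (sum≡0⇒weight≡0 ks eq)) z≤n
  tail≤m (suc s) eq = ℕ.m+n≤o⇒n≤o s (s≤s⁻¹ (subst (λ s → s ℕ.+ weight ks ≤ suc m) eq tail≤1+m))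

-- Splitting the index set by whether k₁ vanishes

increment : ∀ {m} → Vec ℕ (suc m) → Vec ℕ (suc m)
increment ks = updateAt ks zero suc

increment-injective : ∀ {m} {ks ls : Vec ℕ (suc m)} → increment ks ≡ increment ls → ks ≡ ls
increment-injective {ks = _ ∷ _} {_ ∷ _} eq =
  cong₂ _∷_ (ℕ.suc-injective (cong Vec.head eq)) (∷-injectiveʳ eq)

-- A unit in the first position contributes 1 to the sum and 1 to the weight.
isIndex-suc⇔ : ∀ {n k m} j (ks : Vec ℕ m) →
  IsIndex (suc n) (suc k) (suc j ∷ ks) ⇔ IsIndex n k (j ∷ ks)
isIndex-suc⇔ j ks = mk⇔
  (λ (s , w) → ℕ.suc-injective s , ℕ.suc-injective (trans (sym weight-suc) w))
  (λ (s , w) → cong suc s , trans weight-suc (cong suc w))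
  where
  weight-suc : weight (suc j ∷ ks) ≡ suc (weight (j ∷ ks))
  weight-suc = trans (weight-∷ (suc j) ks) (cong suc (sym (weight-∷ j ks)))

-- Removing the leading zero lowers the index of every entry by one, so the weight drops by the sum
-- `k`. In the converse direction `k ≤ n` makes the truncated subtraction exact.
isIndex-0∷⇔ : ∀ {n k m} → k ≤ n → (ks : Vec ℕ m) →
  IsIndex n k (0 ∷ ks) ⇔ IsIndex (n ∸ k) k ks
isIndex-0∷⇔ {n} {k} k≤n ks = mk⇔
  (λ { (refl , refl) → refl , sym (trans (cong (_∸ k) (weight-∷ 0 ks)) (ℕ.m+n∸m≡n k (weight ks))) })
  (λ { (s , w) → s , trans (weight-∷ 0 ks) (trans (cong₂ ℕ._+_ s w) (ℕ.m+[n∸m]≡n k≤n)) })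

-- Without repetitions, equality as sets is equality as bags. A permutation suffices later, since
-- sums in `R` do not depend on the order.
unique∧⊆⊇⇒↭ : ∀ {a} {A : Set a} {xs ys : List A} → Unique xs → Unique ys →
  (∀ {z} → z ∈ xs → z ∈ ys) → (∀ {z} → z ∈ ys → z ∈ xs) → xs ↭ ys
unique∧⊆⊇⇒↭ xs! ys! xs⊆ys ys⊆xs = ∼bag⇒↭ (unique∧set⇒bag xs! ys! (mk⇔ xs⊆ys ys⊆xs))

-- The parameter `zs` lists the tails of the tuples with k₁ = 0, so that both ranges of k share this
-- argument. The lengths agree since `suc n ∸ suc k` computes to `n ∸ k`.
Λ-split : ∀ {n k} (zs : List (Vec ℕ (n ∸ k))) → Unique zs →
  (∀ ks → ks ∈ zs ⇔ IsIndex (suc n) (suc k) (0 ∷ ks)) →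
  Λ (suc n) (suc k) ↭ map increment (Λ n k) ++ map (0 ∷_) zs
Λ-split {n} {k} zs zs! zs⇔ = unique∧⊆⊇⇒↭ (Λ-unique (suc n) (suc k))
  (Unique.++⁺ (Unique.map⁺ increment-injective (Λ-unique n k)) (Unique.map⁺ ∷-injectiveʳ zs!)
    disjoint)
  ⊆ ⊇
  where
  disjoint : ∀ {ks} → ks ∈ map increment (Λ n k) × ks ∈ map (0 ∷_) zs → _
  disjoint (p , q) with ∈-map⁻ increment p | ∈-map⁻ (0 ∷_) q
  ... | (_ ∷ _) , _ , refl | _ , _ , ()

  ⊆ : ∀ {ks} → ks ∈ Λ (suc n) (suc k) → ks ∈ map increment (Λ n k) ++ map (0 ∷_) zs
  ⊆ {zero ∷ ks} p = ∈-++⁺ʳ (map increment (Λ n k))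
    (∈-map⁺ (0 ∷_) (zs⇔ ks .from (∈-Λ (suc n) (suc k) (0 ∷ ks) .to p)))
  ⊆ {suc j ∷ ks} p = ∈-++⁺ˡ (∈-map⁺ increment
    (∈-Λ n k (j ∷ ks) .from (isIndex-suc⇔ j ks .to (∈-Λ (suc n) (suc k) (suc j ∷ ks) .to p))))

  ⊇ : ∀ {ks} → ks ∈ map increment (Λ n k) ++ map (0 ∷_) zs → ks ∈ Λ (suc n) (suc k)
  ⊇ {ks} p = ∈-Λ (suc n) (suc k) ks .from (index (∈-++⁻ (map increment (Λ n k)) p))
    where
    index : _ → IsIndex (suc n) (suc k) ks
    index (inj₁ q) with ∈-map⁻ increment q
    ... | (j ∷ ls) , r , refl = isIndex-suc⇔ j ls .from (∈-Λ n k (j ∷ ls) .to r)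
    index (inj₂ q) with ∈-map⁻ (0 ∷_) q
    ... | ls , r , refl = zs⇔ ls .to r

-- This and the next lemma turn the bound by [n/2] into a comparison of the sum k with the weight n
-- - k of a shifted tuple.
k≤⌊n/2⌋⇒k≤n∸k : ∀ {n k} → k ≤ ⌊ n /2⌋ → k ≤ n ∸ k
k≤⌊n/2⌋⇒k≤n∸k {n} {k} k≤n/2 = ℕ.m+n≤o⇒m≤o∸n k (begin
  k ℕ.+ k              ≤⟨ ℕ.+-mono-≤ k≤n/2 (ℕ.≤-trans k≤n/2 (ℕ.⌊n/2⌋≤⌈n/2⌉ n)) ⟩
  ⌊ n /2⌋ ℕ.+ ⌈ n /2⌉  ≡⟨ ℕ.⌊n/2⌋+⌈n/2⌉≡n n ⟩
  n                    ∎)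
  where open ℕ.≤-Reasoning

k≤n∸k⇒k≤⌊n/2⌋ : ∀ {n k} → k ≤ n → k ≤ n ∸ k → k ≤ ⌊ n /2⌋
k≤n∸k⇒k≤⌊n/2⌋ {n} {k} k≤n k≤n∸k = begin
  k              ≡⟨ ℕ.n≡⌊n+n/2⌋ k ⟩
  ⌊ k ℕ.+ k /2⌋  ≤⟨ ℕ.⌊n/2⌋-mono (ℕ.m≤o∸n⇒m+n≤o k k≤n k≤n∸k) ⟩
  ⌊ n /2⌋        ∎
  where open ℕ.≤-Reasoning

-- Here `zs` is empty: a tail would have sum `suc k` and weight `n ∸ k`, and the sum never exceeds
-- the weight.
Λ-increment : ∀ {n k} → k ≤ n → ⌊ suc n /2⌋ < suc k →
  Λ (suc n) (suc k) ↭ map increment (Λ n k)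
Λ-increment {n} {k} k≤n n/2<k = subst (Λ (suc n) (suc k) ↭_) (++-identityʳ _) $
  Λ-split {n} {k} [] [] λ ks → mk⇔ (λ ()) λ ix →
    let s , w = isIndex-0∷⇔ (s≤s k≤n) ks .to ix in
    contradiction
      (k≤n∸k⇒k≤⌊n/2⌋ (s≤s k≤n) (subst₂ _≤_ s w (sum≤weight ks)))
      (ℕ.<⇒≱ n/2<k)

-- With `m = n ∸ k` this says that the tuples of `Λ (n ∸ k) (suc k)` are no longer than the tails of
-- those of `Λ (suc n) (suc k)`, so `resize` pads them and loses nothing.
1+[m∸[1+k]]≤m : ∀ {m k} → suc k ≤ m → suc (m ∸ suc k) ≤ m
1+[m∸[1+k]]≤m {suc m} {k} _ = s≤s (ℕ.m∸n≤m m k)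

Λ-recurrence : ∀ {n k} → suc k ≤ n ∸ k →
  Λ (suc n) (suc k) ↭ map increment (Λ n k) ++ map (0 ∷_) (map (resize (n ∸ k)) (Λ (n ∸ k) (suc k)))
Λ-recurrence {n} {k} 1+k≤n∸k = Λ-split (map (resize (n ∸ k)) (Λ (n ∸ k) (suc k)))
  (Unique.map⁺ (resize-injective length≤) (Λ-unique (n ∸ k) (suc k)))
  λ ks → mk⇔ (⇒ ks) (⇐ ks)
  where
  length≤ : suc (n ∸ k ∸ suc k) ≤ n ∸ k
  length≤ = 1+[m∸[1+k]]≤m 1+k≤n∸k

  k≤n : suc k ≤ suc n
  k≤n = s≤s (ℕ.≤-trans (ℕ.n≤1+n k) (ℕ.≤-trans 1+k≤n∸k (ℕ.m∸n≤m n k)))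

  ⇒ : ∀ ks → ks ∈ map (resize (n ∸ k)) (Λ (n ∸ k) (suc k)) → IsIndex (suc n) (suc k) (0 ∷ ks)
  ⇒ _ p with ∈-map⁻ (resize (n ∸ k)) p
  ... | ls , q , refl = isIndex-0∷⇔ k≤n (resize (n ∸ k) ls) .from
    (let s , w = ∈-Λ (n ∸ k) (suc k) ls .to q in
      trans (sum-resize length≤ ls) s , trans (weight-resize length≤ ls) w)

  -- The first entry always survives the cut. Splitting it off lowers the weight by the whole sum
  -- `suc k`, so the remaining entries have weight `n ∸ k ∸ suc k`, which is exactly the number of
  -- positions kept for them.
  truncate : ∀ {p} (ks : Vec ℕ p) → IsIndex (n ∸ k) (suc k) ks →
    resize p (resize (suc (n ∸ k ∸ suc k)) ks) ≡ ks
  truncate []       _       = refl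
  truncate (j ∷ ks) (s , w) = cong (j ∷_) (resize-resize _ ks (ℕ.≤-reflexive (begin
    weight ks                             ≡⟨ ℕ.m+n∸m≡n (suc k) (weight ks) ⟨
    suc k ℕ.+ weight ks ∸ suc k           ≡⟨ cong (λ t → t ℕ.+ weight ks ∸ suc k) s ⟨
    j ℕ.+ sum ks ℕ.+ weight ks ∸ suc k    ≡⟨ cong (_∸ suc k) (ℕ.+-assoc j (sum ks) (weight ks)) ⟩
    j ℕ.+ (sum ks ℕ.+ weight ks) ∸ suc k  ≡⟨ cong (_∸ suc k) (trans (sym (weight-∷ j ks)) w) ⟩
    n ∸ k ∸ suc k                         ∎)))
    where open ≡-Reasoning

  ⇐ : ∀ ks → IsIndex (suc n) (suc k) (0 ∷ ks) → ks ∈ map (resize (n ∸ k)) (Λ (n ∸ k) (suc k))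
  -- Cutting may change sum and weight in general, but padding does not; as padding `ls` gives back
  -- `ks`, the two have the same sum and weight.
  ⇐ ks ix = subst (_∈ _) resize-ls (∈-map⁺ (resize (n ∸ k)) (∈-Λ (n ∸ k) (suc k) ls .from
    ( trans (sym (sum-resize length≤ ls)) (trans (cong sum resize-ls) (proj₁ ix′))
    , trans (sym (weight-resize length≤ ls)) (trans (cong weight resize-ls) (proj₂ ix′)))))
    where
    ix′ = isIndex-0∷⇔ k≤n ks .to ix
    ls = resize (suc (n ∸ k ∸ suc k)) ks
    resize-ls = truncate ks ix′

-- The single tuples for k = 1 and k = n

lastUnit : ∀ m → Vec ℕ (suc m)
lastUnit zero    = 1 ∷ []
lastUnit (suc m) = 0 ∷ lastUnit m

isIndex-lastUnit : ∀ m → IsIndex (suc m) 1 (lastUnit m)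
isIndex-lastUnit zero    = refl , refl
isIndex-lastUnit (suc m) = isIndex-0∷⇔ (s≤s z≤n) (lastUnit m) .from (isIndex-lastUnit m)

-- A positive first entry would exhaust the sum 1 and leave weight 1, which is too small once there
-- is a second position. Hence the first entry is 0, and the shift reduces to a shorter tuple.
isIndex⇒lastUnit : ∀ m (ks : Vec ℕ (suc m)) → IsIndex (suc m) 1 ks → ks ≡ lastUnit m
isIndex⇒lastUnit zero    (zero        ∷ []) (() , _)
isIndex⇒lastUnit zero    (suc zero    ∷ []) _ = refl
isIndex⇒lastUnit zero    (suc (suc _) ∷ []) (() , _)
isIndex⇒lastUnit (suc m) (zero        ∷ ks) ix =
  cong (0 ∷_) (isIndex⇒lastUnit m ks (isIndex-0∷⇔ (s≤s z≤n) ks .to ix))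
isIndex⇒lastUnit (suc m) (suc j       ∷ ks) (s , w) = contradiction 1≡2+m λ ()
  where
  sum-ks≡0 : sum ks ≡ 0
  sum-ks≡0 = ℕ.m+n≡0⇒n≡0 j (ℕ.suc-injective s)

  1≡2+m : 1 ≡ suc (suc m)
  1≡2+m = begin
    1
      ≡⟨ s ⟨
    suc j ℕ.+ sum ks
      ≡⟨ cong (suc j ℕ.+_) (ℕ.+-identityʳ (sum ks)) ⟨
    suc j ℕ.+ (sum ks ℕ.+ 0)
      ≡⟨ cong (λ t → suc j ℕ.+ (sum ks ℕ.+ t)) (sum≡0⇒weight≡0 ks sum-ks≡0) ⟨
    suc j ℕ.+ (sum ks ℕ.+ weight ks)
      ≡⟨ weight-∷ (suc j) ks ⟨
    weight (suc j ∷ ks)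
      ≡⟨ w ⟩
    suc (suc m) ∎
    where open ≡-Reasoning

Λ-1 : ∀ m → Λ (suc m) 1 ↭ lastUnit m ∷ []
Λ-1 m = unique∧⊆⊇⇒↭ (Λ-unique (suc m) 1) ([] ∷ [])
  (λ {ks} p → here (isIndex⇒lastUnit m ks (∈-Λ (suc m) 1 ks .to p)))
  (λ { (here refl) → ∈-Λ (suc m) 1 (lastUnit m) .from (isIndex-lastUnit m) })

-- The weight exceeds the sum by the weight of the tail, so equality forces the tail to vanish. The
-- zero tail is a padded empty tuple because its length `n ∸ n` does not reduce for variable `n`.
Λ-diagonal : ∀ n → Λ n n ↭ (n ∷ resize (n ∸ n) []) ∷ []
Λ-diagonal n = unique∧⊆⊇⇒↭ (Λ-unique n n) ([] ∷ [])
  (λ {ks} p → here (⇒ ks (∈-Λ n n ks .to p)))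
  (λ { (here refl) → ∈-Λ n n _ .from ix })
  where
  zeros = resize (n ∸ n) []

  sum-zeros : sum zeros ≡ 0
  sum-zeros = sum-resize {p = n ∸ n} z≤n []

  ix : IsIndex n n (n ∷ zeros)
  ix = trans (cong (n ℕ.+_) sum-zeros) (ℕ.+-identityʳ n)
     , trans (weight-∷ n zeros) (trans
         (cong (n ℕ.+_) (cong₂ ℕ._+_ sum-zeros (sum≡0⇒weight≡0 zeros sum-zeros))) (ℕ.+-identityʳ n))

  ⇒ : ∀ {m} (ks : Vec ℕ (suc m)) → IsIndex n n ks → ks ≡ n ∷ resize m []
  ⇒ {m} (k ∷ ks) (s , w) = cong₂ _∷_ k≡n (sym zeros≡ks)
    where
    weight-ks≡0 : weight ks ≡ 0
    weight-ks≡0 = ℕ.+-cancelˡ-≡ n _ _ (begin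
      n ℕ.+ weight ks               ≡⟨ cong (ℕ._+ weight ks) s ⟨
      k ℕ.+ sum ks ℕ.+ weight ks    ≡⟨ ℕ.+-assoc k (sum ks) (weight ks) ⟩
      k ℕ.+ (sum ks ℕ.+ weight ks)  ≡⟨ weight-∷ k ks ⟨
      weight (k ∷ ks)               ≡⟨ w ⟩
      n                             ≡⟨ ℕ.+-identityʳ n ⟨
      n ℕ.+ 0                       ∎)
      where open ≡-Reasoning

    -- Weight 0 allows cutting down to length 0, and `resize 0 ks` is `[]`.
    zeros≡ks : resize m [] ≡ ks
    zeros≡ks = resize-resize 0 ks (ℕ.≤-reflexive weight-ks≡0)

    k≡n : k ≡ n
    k≡n = trans (sym (ℕ.+-identityʳ k)) (trans
      (cong (k ℕ.+_) (sym (ℕ.n≤0⇒n≡0 (ℕ.≤-trans (sum≤weight ks) (ℕ.≤-reflexive weight-ks≡0))))) s)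

-- Factorials and fractions

nPk*[n∸k]!≡n! : ∀ {n k} → k ≤ n → (n P k) ℕ.* (n ∸ k) ! ≡ n !
nPk*[n∸k]!≡n! {n} {k} k≤n = trans (cong (ℕ._* (n ∸ k) !) (nPk≡n!/[n∸k]! k≤n))
  (m/n*n≡m (m≤n⇒m!∣n! (ℕ.m∸n≤m n k)))
  where instance _ = (n ∸ k) !≢0

-- For unnormalised fractions, cross-multiplication leaves a polynomial identity over the integers.
1/d+n/d≡1+n/d : ∀ n d → (+ 1) / suc d ℚ.+ (+ n) / suc d ≡ (+ suc n) / suc d
1/d+n/d≡1+n/d n d = ℚ.toℚᵘ-injective (begin
  toℚᵘ (fromℚᵘ 1/d ℚ.+ fromℚᵘ n/d)          ≈⟨ ℚ.toℚᵘ-homo-+ (fromℚᵘ 1/d) (fromℚᵘ n/d) ⟩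
  toℚᵘ (fromℚᵘ 1/d) ℚᵘ.+ toℚᵘ (fromℚᵘ n/d)  ≈⟨ ℚᵘ.+-cong (ℚ.toℚᵘ-fromℚᵘ 1/d) (ℚ.toℚᵘ-fromℚᵘ n/d) ⟩
  1/d ℚᵘ.+ n/d                              ≈⟨ sum≃ ⟩
  mkℚᵘ (+ suc n) d                          ≈⟨ ℚ.toℚᵘ-fromℚᵘ (mkℚᵘ (+ suc n) d) ⟨
  toℚᵘ (fromℚᵘ (mkℚᵘ (+ suc n) d))          ∎)
  where
  open SetoidReasoning ℚᵘ.≃-setoid
  open ℤ.+-*-Solver
  1/d = mkℚᵘ (+ 1) d
  n/d = mkℚᵘ (+ n) d

  sum≃ : 1/d ℚᵘ.+ n/d ℚᵘ.≃ mkℚᵘ (+ suc n) d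
  sum≃ = *≡* (solve 2 (λ n d →
    (con (+ 1) :* d :+ n :* d) :* d := (con (+ 1) :+ n) :* (d :* d)) refl (+ n) (+ suc d))

n/n≡1 : ∀ n → (+ suc n) / suc n ≡ 1ℚ
n/n≡1 n = ℚ.fromℚᵘ-cong {mkℚᵘ (+ suc n) n} {mkℚᵘ (+ 1) 0} (*≡* (ℤ.*-comm (+ suc n) (+ 1)))

-- Sums and summands evaluated in `R`

module BellProperties
  {c ℓ} (R : CommutativeRing c ℓ) (ι : ℚ → CommutativeRing.Carrier R)
  (ι-homo : IsRingHomomorphism +-*-rawRing (CommutativeRing.rawRing R) ι) where

  open Bell R ι
  open CommutativeRing R hiding (Carrier; _≈_; _+_; _*_; 0#; zero; refl; sym; trans)
  open CommutativeRing R using () renaming (refl to ≈-refl; sym to ≈-sym; trans to ≈-trans)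
  open IsRingHomomorphism ι-homo using (⟦⟧-cong; +-homo; 0#-homo; 1#-homo)
  open SemiringMult semiring using (×-congʳ; ×-congˡ; ×-assocˡ; ×-assoc-*; ×-comm-*)
  open CommutativeMonoidMult +-commutativeMonoid using (×-distrib-+)
  open CommutativeSemiringExp commutativeSemiring using (^-congˡ)
  open SetoidReasoning setoid

  -- Additivity of `ι` gives this by induction on `n`; taking `n` equal to the denominator makes n!
  -- cancel against 1/n! in `R`.
  n·ι[1/d]≈ι[n/d] : ∀ n d → n · ι ((+ 1) / suc d) ≈ ι ((+ n) / suc d)
  n·ι[1/d]≈ι[n/d] zero    d = ≈-sym (≈-trans (⟦⟧-cong (ℚ.0/n≡0 (suc d))) 0#-homo)
  n·ι[1/d]≈ι[n/d] (suc n) d = begin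
    ι ((+ 1) / suc d) + n · ι ((+ 1) / suc d)  ≈⟨ +-congˡ (n·ι[1/d]≈ι[n/d] n d) ⟩
    ι ((+ 1) / suc d) + ι ((+ n) / suc d)      ≈⟨ +-homo _ _ ⟨
    ι ((+ 1) / suc d ℚ.+ (+ n) / suc d)        ≈⟨ ⟦⟧-cong (1/d+n/d≡1+n/d n d) ⟩
    ι ((+ suc n) / suc d)                      ∎

  n·ι[1/n]≈1 : ∀ n .{{_ : ℕ.NonZero n}} → n · ι ((+ 1) / n) ≈ 1#
  n·ι[1/n]≈1 (suc n) = ≈-trans (n·ι[1/d]≈ι[n/d] (suc n) n) (≈-trans (⟦⟧-cong (n/n≡1 n)) 1#-homo)

  n!·1/n!≈1 : ∀ n → (n !) · 1/ n ! ≈ 1#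
  n!·1/n!≈1 n = n·ι[1/n]≈1 (n !) {{n ℕ.!≢0}}

  n!·x*1/n!≈x : ∀ n x → ((n !) · x) * 1/ n ! ≈ x
  n!·x*1/n!≈x n x = begin
    ((n !) · x) * 1/ n !  ≈⟨ ×-assoc-* (n !) x (1/ n !) ⟩
    (n !) · (x * 1/ n !)  ≈⟨ ×-comm-* (n !) x (1/ n !) ⟨
    x * ((n !) · 1/ n !)  ≈⟨ *-congˡ (n!·1/n!≈1 n) ⟩
    x * 1#                ≈⟨ *-identityʳ x ⟩
    x                     ∎

  ∑-cong : ∀ {a} {A : Set a} (xs : List A) {f g : A → Carrier} →
    (∀ x → f x ≈ g x) → ∑ xs f ≈ ∑ xs g
  ∑-cong []       f≈g = ≈-refl
  ∑-cong (x ∷ xs) f≈g = +-cong (f≈g x) (∑-cong xs f≈g)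

  ∑-↭ : ∀ {a} {A : Set a} {xs ys : List A} (f : A → Carrier) → xs ↭ ys → ∑ xs f ≈ ∑ ys f
  ∑-↭ f xs↭ys = Permutation.foldr-commMonoid setoid +-isCommutativeMonoid
    (↭⇒↭ₛ′ isEquivalence (map⁺ f xs↭ys))

  ∑-++ : ∀ {a} {A : Set a} (xs ys : List A) (f : A → Carrier) →
    ∑ (xs ++ ys) f ≈ ∑ xs f + ∑ ys f
  ∑-++ []       ys f = ≈-sym (+-identityˡ (∑ ys f))
  ∑-++ (x ∷ xs) ys f = ≈-trans (+-congˡ (∑-++ xs ys f)) (≈-sym (+-assoc (f x) (∑ xs f) (∑ ys f)))

  ∑-map : ∀ {a b} {A : Set a} {B : Set b} (g : A → B) (xs : List A) (f : B → Carrier) →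
    ∑ (map g xs) f ≈ ∑ xs (f ∘ g)
  ∑-map g xs f = reflexive (cong (List.foldr _+_ 0#) (sym (map-∘ xs)))

  -- The variables come from an infinite sequence starting at `v 0`, not from a vector of fixed
  -- length, so that summands of tuples of different lengths can be compared.
  monomial : ∀ {m} → (ℕ → Carrier) → Vec ℕ m → Carrier
  monomial v []       = 1#
  monomial v (k ∷ ks) = 1/ k ! * v 0 ^ k * monomial (v ∘ suc) ks

  product≈monomial : ∀ {m} (y : Vector Carrier m) (v : ℕ → Carrier) →
    (∀ i → y i ≈ v (toℕ i)) → (ks : Vec ℕ m) →
    product (λ i → 1/ lookup ks i ! * y i ^ lookup ks i) ≈ monomial v ks
  product≈monomial y v y≈v []       = ≈-refl
  product≈monomial y v y≈v (k ∷ ks) = *-cong (*-congˡ (^-congˡ k (y≈v zero)))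
    (product≈monomial (y ∘ suc) (v ∘ suc) (y≈v ∘ suc) ks)

  summand≈monomial : ∀ {m} (u : ℕ → Carrier) (ks : Vec ℕ m) →
    summand ⟨ (λ j → (j !) · u j) ⟩ ks ≈ monomial (u ∘ suc) ks
  summand≈monomial u = product≈monomial _ (u ∘ suc) λ i → n!·x*1/n!≈x (suc (toℕ i)) (u (suc (toℕ i)))

  monomial-0∷ : ∀ {m} (v : ℕ → Carrier) (ks : Vec ℕ m) → monomial v (0 ∷ ks) ≈ monomial (v ∘ suc) ks
  monomial-0∷ v ks = begin
    -- The coefficient `1/ 0 !` computes to `ι 1ℚ`.
    1/ 0 ! * 1# * monomial (v ∘ suc) ks  ≈⟨ *-congʳ (≈-trans (*-identityʳ (1/ 0 !)) 1#-homo) ⟩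
    1# * monomial (v ∘ suc) ks           ≈⟨ *-identityˡ _ ⟩
    monomial (v ∘ suc) ks                ∎

  monomial-resize : ∀ {m p} → m ≤ p → ∀ (v : ℕ → Carrier) (ks : Vec ℕ m) →
    monomial v (resize p ks) ≈ monomial v ks
  monomial-resize {p = zero}  _         v []       = ≈-refl
  monomial-resize {p = suc p} _         v []       =
    ≈-trans (monomial-0∷ v (resize p [])) (monomial-resize {p = p} z≤n (v ∘ suc) [])
  monomial-resize             (s≤s m≤p) v (k ∷ ks) = *-congˡ (monomial-resize m≤p (v ∘ suc) ks)

  monomial-lastUnit : ∀ m (v : ℕ → Carrier) → monomial v (lastUnit m) ≈ v m
  monomial-lastUnit zero    v = begin
    1/ 1 ! * (v 0 * 1#) * 1#  ≈⟨ *-identityʳ _ ⟩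
    1/ 1 ! * (v 0 * 1#)       ≈⟨ *-cong 1#-homo (*-identityʳ (v 0)) ⟩
    1# * v 0                  ≈⟨ *-identityˡ (v 0) ⟩
    v 0                       ∎
  monomial-lastUnit (suc m) v =
    ≈-trans (monomial-0∷ v (lastUnit m)) (monomial-lastUnit m (v ∘ suc))

  -- The identities for Bell polynomials

  B-1 : ∀ (u : ℕ → Carrier) n → B (suc n) 1 ⟨ (λ j → (j !) · u j) ⟩ ≈ (suc n !) · u (suc n)
  B-1 u n = ×-congʳ (suc n !) (begin
    ∑ (Λ (suc n) 1) (summand x)      ≈⟨ ∑-↭ (summand x) (Λ-1 n) ⟩
    summand x (lastUnit n) + 0#      ≈⟨ +-identityʳ _ ⟩
    summand x (lastUnit n)           ≈⟨ summand≈monomial u (lastUnit n) ⟩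
    monomial (u ∘ suc) (lastUnit n)  ≈⟨ monomial-lastUnit n (u ∘ suc) ⟩
    u (suc n)                        ∎)
    where
    x : Vector Carrier (suc n)
    x = ⟨ (λ j → (j !) · u j) ⟩

  B-diagonal : ∀ (u : ℕ → Carrier) n → B n n ⟨ u ⟩ ≈ u 1 ^ n
  B-diagonal u n = begin
    (n !) · ∑ (Λ n n) (summand ⟨ u ⟩)
      ≈⟨ ×-congʳ (n !) (∑-↭ (summand ⟨ u ⟩) (Λ-diagonal n)) ⟩
    (n !) · (summand ⟨ u ⟩ (n ∷ zeros) + 0#)
      ≈⟨ ×-congʳ (n !) (+-identityʳ _) ⟩
    (n !) · summand ⟨ u ⟩ (n ∷ zeros)
      ≈⟨ ×-congʳ (n !) (product≈monomial _ v (λ _ → ≈-refl) (n ∷ zeros)) ⟩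
    (n !) · (1/ n ! * v 0 ^ n * monomial (v ∘ suc) zeros)
      ≈⟨ ×-congʳ (n !) (*-congˡ (monomial-resize {p = n ∸ n} z≤n (v ∘ suc) [])) ⟩
    (n !) · (1/ n ! * v 0 ^ n * 1#)
      ≈⟨ ×-congʳ (n !) (*-identityʳ _) ⟩
    (n !) · (1/ n ! * v 0 ^ n)
      ≈⟨ ×-assoc-* (n !) (1/ n !) (v 0 ^ n) ⟨
    ((n !) · 1/ n !) * v 0 ^ n
      ≈⟨ *-cong (n!·1/n!≈1 n) (^-congˡ n u₁*1/1!≈u₁) ⟩
    1# * u 1 ^ n
      ≈⟨ *-identityˡ (u 1 ^ n) ⟩
    u 1 ^ n ∎
    where
    zeros = resize (n ∸ n) []

    -- The arguments are the plain `u j` here, so the factor 1/j! stays; at j = 1 it is 1.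
    v : ℕ → Carrier
    v j = u (suc j) * 1/ suc j !

    u₁*1/1!≈u₁ : u 1 * 1/ 1 ! ≈ u 1
    u₁*1/1!≈u₁ = ≈-trans (*-congˡ 1#-homo) (*-identityʳ (u 1))

  -- The part with k₁ > 0 of both recurrences: mapping `increment` over the list is the replacement
  -- k₁ → k₁ + 1 in the summands.
  ∑-Λ-increment : ∀ (u : ℕ → Carrier) n k →
    let x = ⟨ (λ j → (j !) · u j) ⟩ in
    (suc n !) · ∑ (map increment (Λ n k)) (summand x) ≈ suc n · B[k₁→k₁+1] n k x
  ∑-Λ-increment u n k = begin
    (suc n ℕ.* n !) · ∑ (map increment (Λ n k)) (summand x)   ≈⟨ ×-assocˡ _ (suc n) (n !) ⟨
    suc n · ((n !) · ∑ (map increment (Λ n k)) (summand x))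
      ≈⟨ ×-congʳ (suc n) (×-congʳ (n !) (∑-map increment (Λ n k) (summand x))) ⟩
    suc n · B[k₁→k₁+1] n k x ∎
    where
    x : Vector Carrier (suc (n ∸ k))
    x = ⟨ (λ j → (j !) · u j) ⟩

  B-increment : ∀ (u : ℕ → Carrier) {n k} → k ≤ n → ⌊ suc n /2⌋ < suc k →
    B (suc n) (suc k) ⟨ (λ j → (j !) · u j) ⟩ ≈ suc n · B[k₁→k₁+1] n k ⟨ (λ j → (j !) · u j) ⟩
  B-increment u {n} {k} k≤n n/2<k = begin
    (suc n !) · ∑ (Λ (suc n) (suc k)) (summand x)
      ≈⟨ ×-congʳ (suc n !) (∑-↭ (summand x) (Λ-increment k≤n n/2<k)) ⟩
    (suc n !) · ∑ (map increment (Λ n k)) (summand x)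
      ≈⟨ ∑-Λ-increment u n k ⟩
    suc n · B[k₁→k₁+1] n k x ∎
    where
    x : Vector Carrier (suc (n ∸ k))
    x = ⟨ (λ j → (j !) · u j) ⟩

  B-recurrence : ∀ (u : ℕ → Carrier) {n k} → suc k ≤ n ∸ k →
    B (suc n) (suc k) ⟨ (λ j → (j !) · u j) ⟩
      ≈ suc n · B[k₁→k₁+1] n k ⟨ (λ j → (j !) · u j) ⟩
        + (suc n P suc k) · B (n ∸ k) (suc k) ⟨ (λ j → (j !) · u (suc j)) ⟩
  B-recurrence u {n} {k} 1+k≤n∸k = begin
    (suc n !) · ∑ (Λ (suc n) (suc k)) f
      ≈⟨ ×-congʳ (suc n !) (∑-↭ f (Λ-recurrence 1+k≤n∸k)) ⟩
    (suc n !) · ∑ (map increment (Λ n k) ++ map (0 ∷_) (map (resize (n ∸ k)) Λ′)) f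
      ≈⟨ ×-congʳ (suc n !) (∑-++ (map increment (Λ n k)) _ f) ⟩
    (suc n !) · (∑ (map increment (Λ n k)) f + ∑ (map (0 ∷_) (map (resize (n ∸ k)) Λ′)) f)
      ≈⟨ ×-distrib-+ _ _ (suc n !) ⟩
    (suc n !) · ∑ (map increment (Λ n k)) f + (suc n !) · ∑ (map (0 ∷_) (map (resize (n ∸ k)) Λ′)) f
      ≈⟨ +-cong (∑-Λ-increment u n k) (×-congʳ (suc n !) ∑-Λ′) ⟩
    suc n · B[k₁→k₁+1] n k x + (suc n !) · ∑ Λ′ (summand x′)
      -- The factor `(n ∸ k) !` split off here is the one in front of the sum defining
      -- `B (n ∸ k) (suc k)`.
      ≈⟨ +-congˡ (×-congˡ (nPk*[n∸k]!≡n! 1+k≤1+n)) ⟨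
    suc n · B[k₁→k₁+1] n k x + ((suc n P suc k) ℕ.* (n ∸ k) !) · ∑ Λ′ (summand x′)
      ≈⟨ +-congˡ (×-assocˡ _ (suc n P suc k) ((n ∸ k) !)) ⟨
    suc n · B[k₁→k₁+1] n k x + (suc n P suc k) · B (n ∸ k) (suc k) x′ ∎
    where
    x : Vector Carrier (suc (n ∸ k))
    x = ⟨ (λ j → (j !) · u j) ⟩

    x′ : Vector Carrier (suc (n ∸ k ∸ suc k))
    x′ = ⟨ (λ j → (j !) · u (suc j)) ⟩

    f = summand x
    Λ′ = Λ (n ∸ k) (suc k)

    1+k≤1+n : suc k ≤ suc n
    1+k≤1+n = ℕ.≤-trans 1+k≤n∸k (ℕ.≤-trans (ℕ.m∸n≤m n k) (ℕ.n≤1+n n))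

    v : ℕ → Carrier
    v j = u (suc (suc j))

    -- The leading zero contributes 1 and moves the variables from `u j` to `u (suc j)`; the padding
    -- zeros contribute 1 as well.
    f-0∷resize : ∀ ks → f (0 ∷ resize (n ∸ k) ks) ≈ summand x′ ks
    f-0∷resize ks = begin
      f (0 ∷ resize (n ∸ k) ks)                   ≈⟨ summand≈monomial u (0 ∷ resize (n ∸ k) ks) ⟩
      monomial (u ∘ suc) (0 ∷ resize (n ∸ k) ks)  ≈⟨ monomial-0∷ (u ∘ suc) (resize (n ∸ k) ks) ⟩
      monomial v (resize (n ∸ k) ks)              ≈⟨ monomial-resize (1+[m∸[1+k]]≤m 1+k≤n∸k) v ks ⟩
      monomial v ks                               ≈⟨ summand≈monomial (u ∘ suc) ks ⟨
      summand x′ ks                               ∎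

    ∑-Λ′ : ∑ (map (0 ∷_) (map (resize (n ∸ k)) Λ′)) f ≈ ∑ Λ′ (summand x′)
    ∑-Λ′ = begin
      ∑ (map (0 ∷_) (map (resize (n ∸ k)) Λ′)) f
        ≈⟨ ∑-map (0 ∷_) (map (resize (n ∸ k)) Λ′) f ⟩
      ∑ (map (resize (n ∸ k)) Λ′) (λ ks → f (0 ∷ ks))
        ≈⟨ ∑-map (resize (n ∸ k)) Λ′ (λ ks → f (0 ∷ ks)) ⟩
      ∑ Λ′ (λ ks → f (0 ∷ resize (n ∸ k) ks))
        ≈⟨ ∑-cong Λ′ f-0∷resize ⟩
      ∑ Λ′ (summand x′) ∎

corollary2p2 : ∀ {c ℓ} (R : CommutativeRing c ℓ)
    (ι : ℚ → CommutativeRing.Carrier R) →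
    IsRingHomomorphism +-*-rawRing (CommutativeRing.rawRing R) ι →
    let open Bell R ι in
    (u : ℕ → Carrier) →
    (∀ n → 1 ≤ n →
    B n 1 ⟨ (λ j → (j !) · u j) ⟩ ≈ (n !) · u n
    × B n n ⟨ u ⟩ ≈ u 1 ^ n)
    ×
    (∀ n k → 2 ≤ n → ⌊ n /2⌋ < k → k ≤ n →
    B n k ⟨ (λ j → (j !) · u j) ⟩
    ≈ n · B[k₁→k₁+1] (n ∸ 1) (k ∸ 1) ⟨ (λ j → (j !) · u j) ⟩)
    ×
    (∀ n k → 4 ≤ n → 2 ≤ k → k ≤ ⌊ n /2⌋ →
    B n k ⟨ (λ j → (j !) · u j) ⟩
    ≈ n · B[k₁→k₁+1] (n ∸ 1) (k ∸ 1) ⟨ (λ j → (j !) · u j) ⟩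
    + (n P k) · B (n ∸ k) k ⟨ (λ j → (j !) · u (suc j)) ⟩)
corollary2p2 R ι ι-homo u =
    (λ { (suc n) _ → B-1 u n , B-diagonal u (suc n) })
  , (λ { (suc n) (suc k) _ n/2<k (s≤s k≤n) → B-increment u k≤n n/2<k
       ; (suc (suc n)) zero _ () _ })
  , (λ { n@(suc _) (suc k) _ _ k≤n/2 → B-recurrence u (k≤⌊n/2⌋⇒k≤n∸k {n} k≤n/2) })
  where open BellProperties R ι ι-homo
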